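{- Let $G$ be an outerplanar graph of order $n$. Then $I_2(G) \ge \frac{5n}{7}$.
   Context: All graphs are finite, simple and undirected; the order of a graph is its number of vertices. A path decomposition of a graph $G$ is a sequence of subsets (bags) $X_1,\dots,X_m$ of $V(G)$ such that (i) $\bigcup_i X_i=V(G)$; (ii) for each edge $uv$ of $G$ there is an index $i$ with $\{u,v\}\subseteq X_i$; (iii) for any indices $i\le j\le k$, $X_i\cap X_k\subseteq X_j$. Its width is $\max_i|X_i|-1$, and the pathwidth $pw(G)$ is the minimum width of a path decomposition of $G$. $I_2(G)$ is the maximum order of an induced subgraph of $G$ with pathwidth at most $2$. -}

module Defs where

open import Data.Bool.Base using (true; false)
open import Data.Fin.Base as Fin using (Fin; zero; suc; toℕ; fromℕ<; punchIn; punchOut)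
open import Data.Fin.Patterns using (0F)
import Data.Fin.Properties as Fin
open import Data.Fin.Permutation using (Permutation′; _⟨$⟩ʳ_)
open import Data.Fin.Subset using (Subset; _∈_; _⊆_; _∩_; ∣_∣; ⊤; ⊥)
open import Data.Fin.Subset.Properties
  using (anySubset?; _∈?_; _⊆?_; ∣p∣≤n; ∈⊤; ∣⊥∣≡0; x∈p∩q⁺; p∩q⊆p)
open import Data.Integer.Base as ℤ using (ℤ; +_; _⊖_)
import Data.Integer.Properties as ℤ
open import Data.Nat.Base using (ℕ; zero; suc; _≤_; _<_; z≤n; s≤s; s≤s⁻¹; _⊔_)
open import Data.Nat.Properties
open import Data.Product.Base using (Σ; ∃; _×_; _,_; proj₁; proj₂)
open import Data.Sum.Base using (inj₁; inj₂)
open import Data.Vec.Base using (Vec; []; _∷_; lookup; map; foldr′; removeAt)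
open import Data.Vec.Properties using (removeAt-punchOut)
open import Function.Base using (_∘_; flip)
open import Level using (0ℓ)
open import Relation.Binary.Core using (Rel)
open import Relation.Binary.Definitions using (Decidable; Symmetric)
open import Relation.Binary.PropositionalEquality
  using (_≡_; _≢_; refl; sym; trans; cong; cong₂; subst; subst₂)
open import Relation.Nullary.Decidable
  using (Dec; yes; no; map′; _×-dec_; _→-dec_; ¬?; decidable-stable)
open import Relation.Nullary.Negation using (¬_; contradiction)
import Relation.Unary as U

private
  variable
    m n : ℕ

-- Adjacency is decidable because the edge set is a finite set of pairs.

record Graph (n : ℕ) : Set₁ where
  field
    Adj        : Rel (Fin n) 0ℓ
    Adj?       : Decidable Adj
    Adj-sym    : Symmetric Adj
    Adj-irrefl : ∀ v → ¬ Adj v v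

elements : (S : Subset n) → Vec (Fin n) ∣ S ∣
elements []          = []
elements (true ∷ S)  = zero ∷ map suc (elements S)
elements (false ∷ S) = map suc (elements S)

-- The induced subgraph, whose i-th vertex is the i-th smallest member of S.

_[_] : Graph n → (S : Subset n) → Graph ∣ S ∣
G [ S ] = record
  { Adj        = λ i j → Adj (member i) (member j)
  ; Adj?       = λ i j → Adj? (member i) (member j)
  ; Adj-sym    = Adj-sym
  ; Adj-irrefl = λ i → Adj-irrefl (member i)
  }
  where
  open Graph G
  member = lookup (elements S)

-- A crossing-free drawing of G with all vertices on the outer face, in the
-- form of a drawing in a closed disc with the vertices on its boundary.
-- The vertices occupy n points of the circle, numbered in cyclic order.
-- Two edges drawn inside the disc have to cross precisely when their four
-- ends are distinct and alternate around the circle.  As Adj is symmetric,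
-- naming the ends so that they occur in the order a, c, b, d loses no
-- generality.

record OuterplanarDrawing (G : Graph n) : Set where
  open Graph G
  field
    placement : Permutation′ n

  pos : Fin n → Fin n
  pos v = placement ⟨$⟩ʳ v

  field
    noncrossing : ∀ {a b c d} → Adj a b → Adj c d →
                  ¬ (pos a Fin.< pos c × pos c Fin.< pos b × pos b Fin.< pos d)

Outerplanar : Graph n → Set
Outerplanar G = OuterplanarDrawing G

IsLeast : ∀ {a ℓ p} {A : Set a} → Rel A ℓ → U.Pred A p → A → Set _
IsLeast _≼_ P x = P x × (∀ {y} → P y → x ≼ y)

IsGreatest : ∀ {a ℓ p} {A : Set a} → Rel A ℓ → U.Pred A p → A → Set _
IsGreatest _≼_ = IsLeast (flip _≼_)

opaque

  least : ∀ {p} {P : U.Pred ℕ p} → U.Decidable P →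
          ∀ b → P b → ∃ (IsLeast _≤_ P)
  least P? zero    p = zero , p , λ _ → z≤n
  least {P = P} P? (suc b) p with P? zero
  ... | yes p₀ = zero , p₀ , λ _ → z≤n
  ... | no ¬p₀ with least (P? ∘ suc) b p
  ...   | x , px , x≤ = suc x , px , λ
            { {zero}  py → contradiction py ¬p₀
            ; {suc y} py → s≤s (x≤ py) }

  greatest : ∀ {p} {P : U.Pred ℕ p} → U.Decidable P → ∀ b →
             (∀ {y} → P y → y ≤ b) → ∃ P → ∃ (IsGreatest _≤_ P)
  greatest {P = P} P? b P≤b (x , px) with P? b
  ... | yes pb = b , pb , P≤b
  greatest {P = P} P? zero    P≤b (x , px) | no ¬pb =
    contradiction (subst P (n≤0⇒n≡0 (P≤b px)) px) ¬pb
  greatest {P = P} P? (suc b) P≤b (x , px) | no ¬pb =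
    greatest P? b
      (λ py → s≤s⁻¹ (≤∧≢⇒< (P≤b py) λ { refl → ¬pb py })) (x , px)

  leastFin : ∀ {p} {P : U.Pred (Fin n) p} → U.Decidable P →
             ∃ P → ∃ (IsLeast Fin._≤_ P)
  leastFin {n = suc n} P? (x , px) with P? zero
  ... | yes p₀ = zero , p₀ , λ _ → z≤n
  leastFin {n = suc n} P? (zero  , px) | no ¬p₀ = contradiction px ¬p₀
  leastFin {n = suc n} P? (suc x , px) | no ¬p₀
    with leastFin (P? ∘ suc) (x , px)
  ... | i , pi , i≤ = suc i , pi , λ
          { {zero}  py → contradiction py ¬p₀
          ; {suc y} py → s≤s (i≤ py) }

record IsPathDecomposition (G : Graph n) (X : Vec (Subset n) m) : Set where
  open Graph G
  field
    vertices : ∀ v → ∃ λ i → v ∈ lookup X i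
    edges    : ∀ u v → Adj u v → ∃ λ i → u ∈ lookup X i × v ∈ lookup X i
    convex   : ∀ i j k → i Fin.≤ j → j Fin.≤ k →
               lookup X i ∩ lookup X k ⊆ lookup X j

record PathDecomposition (G : Graph n) : Set where
  field
    {len}               : ℕ
    bags                : Vec (Subset n) len
    isPathDecomposition : IsPathDecomposition G bags

maxBagSize : Vec (Subset n) m → ℕ
maxBagSize X = foldr′ _⊔_ 0 (map ∣_∣ X)

-- The width is an integer because the graph of order 0 has a path
-- decomposition of width -1.

width : {G : Graph n} → PathDecomposition G → ℤ
width D = maxBagSize (PathDecomposition.bags D) ⊖ 1

HasWidth : Graph n → ℤ → Set
HasWidth G w = Σ (PathDecomposition G) λ D → width D ≡ w

-- The minimum defining the pathwidth exists: a path decomposition of a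
-- graph of order n can be shortened to at most n bags without increasing
-- its width, so there are only finitely many candidates.

private
  anyVec? : ∀ {p} m {P : U.Pred (Vec (Subset n) m) p} →
            U.Decidable P → Dec (∃ P)
  anyVec? zero    P? = map′ ([] ,_) (λ { ([] , p) → p }) (P? [])
  anyVec? (suc m) P? =
    map′ (λ { (S , X , p) → S ∷ X , p }) (λ { (S ∷ X , p) → S , X , p })
         (anySubset? λ S → anyVec? m λ X → P? (S ∷ X))

  isPathDecomposition? : (G : Graph n) (X : Vec (Subset n) m) →
                         Dec (IsPathDecomposition G X)
  isPathDecomposition? G X =
    map′ (λ (c , e , i) → record { vertices = c ; edges = e ; convex = i })
         (λ D → IsPathDecomposition.vertices D , IsPathDecomposition.edges D ,
                IsPathDecomposition.convex D)
         ( Fin.all? (λ v → Fin.any? λ i → v ∈? lookup X i)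
         ×-dec Fin.all? (λ u → Fin.all? λ v → Adj? u v →-dec
                 Fin.any? λ i → u ∈? lookup X i ×-dec v ∈? lookup X i)
         ×-dec Fin.all? (λ i → Fin.all? λ j → Fin.all? λ k →
                 i Fin.≤? j →-dec (j Fin.≤? k →-dec
                 lookup X i ∩ lookup X k ⊆? lookup X j)))
    where open Graph G

  lookup-removeAt : ∀ {a} {A : Set a} (xs : Vec A (suc m)) k i →
                    lookup (removeAt xs k) i ≡ lookup xs (punchIn k i)
  lookup-removeAt (x ∷ xs)         zero    i       = refl
  lookup-removeAt (x ∷ xs@(_ ∷ _)) (suc k) zero    = refl
  lookup-removeAt (x ∷ xs@(_ ∷ _)) (suc k) (suc i) = lookup-removeAt xs k i

  maxBagSize-removeAt : (X : Vec (Subset n) (suc m)) (k : Fin (suc m)) →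
                        maxBagSize (removeAt X k) ≤ maxBagSize X
  maxBagSize-removeAt (S ∷ X)         zero    = m≤n⊔m ∣ S ∣ _
  maxBagSize-removeAt (S ∷ X@(_ ∷ _)) (suc k) =
    ⊔-monoʳ-≤ ∣ S ∣ (maxBagSize-removeAt X k)

  missed : n < m → (f : Fin n → Fin m) → ∃ λ k → ∀ v → k ≢ f v
  missed {n} {m} n<m f with Fin.any? (λ k → Fin.all? λ v → ¬? (k Fin.≟ f v))
  ... | yes found = found
  ... | no ¬found = contradiction (Fin.injective⇒≤ {f = g} inj) (<⇒≱ n<m)
    where
    hit : (k : Fin m) → ∃ λ v → k ≡ f v
    hit k = decidable-stable (Fin.any? λ v → k Fin.≟ f v)
              λ ¬hit → ¬found (k , λ v eq → ¬hit (v , eq))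
    g : Fin m → Fin n
    g k = proj₁ (hit k)
    inj : ∀ {i j} → g i ≡ g j → i ≡ j
    inj {i} {j} eq =
      trans (proj₂ (hit i)) (trans (cong f eq) (sym (proj₂ (hit j))))

  module DropBag (G : Graph n) (X : Vec (Subset n) (suc m)) (n<m : n < suc m)
                 (D : IsPathDecomposition G X) where

    open IsPathDecomposition D

    firsts : ∀ v → ∃ (IsLeast Fin._≤_ λ i → v ∈ lookup X i)
    firsts v = leastFin (λ i → v ∈? lookup X i) (vertices v)

    first : Fin n → Fin (suc m)
    first v = proj₁ (firsts v)

    first-∈ : ∀ v → v ∈ lookup X (first v)
    first-∈ v = proj₁ (proj₂ (firsts v))

    first-≤ : ∀ v {i} → v ∈ lookup X i → first v Fin.≤ i
    first-≤ v = proj₂ (proj₂ (firsts v))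

    k : Fin (suc m)
    k = proj₁ (missed n<m first)

    k≢ : ∀ v → k ≢ first v
    k≢ = proj₂ (missed n<m first)

    Y : Vec (Subset n) m
    Y = removeAt X k

    at : Fin n → Fin m
    at v = punchOut (k≢ v)

    into : ∀ u v → u ∈ lookup X (first v) → u ∈ lookup Y (at v)
    into u v = subst (u ∈_) (sym (removeAt-punchOut X (k≢ v)))

    later : ∀ u v {i} → first u Fin.≤ first v →
            u ∈ lookup X i → v ∈ lookup X i → u ∈ lookup X (first v)
    later u v {i} u≤v u∈ v∈ =
      convex (first u) (first v) i u≤v (first-≤ v v∈)
             (x∈p∩q⁺ (first-∈ u , u∈))

    edges′ : ∀ u v → Graph.Adj G u v →
             ∃ λ i → u ∈ lookup Y i × v ∈ lookup Y i
    edges′ u v uv with edges u v uv | ≤-total (toℕ (first u)) (toℕ (first v))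
    ... | i , u∈ , v∈ | inj₁ u≤v =
      at v , into u v (later u v u≤v u∈ v∈) , into v v (first-∈ v)
    ... | i , u∈ , v∈ | inj₂ v≤u =
      at u , into u u (first-∈ u) , into v u (later v u v≤u v∈ u∈)

    convex′ : ∀ i j l → i Fin.≤ j → j Fin.≤ l →
              lookup Y i ∩ lookup Y l ⊆ lookup Y j
    convex′ i j l i≤j j≤l
      rewrite lookup-removeAt X k i
            | lookup-removeAt X k j
            | lookup-removeAt X k l
      = convex (punchIn k i) (punchIn k j) (punchIn k l)
               (Fin.punchIn-mono-≤ k i j i≤j) (Fin.punchIn-mono-≤ k j l j≤l)

    isPathDecomposition : IsPathDecomposition G Y
    isPathDecomposition = record
      { vertices = λ v → at v , into v v (first-∈ v)
      ; edges    = edges′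
      ; convex   = convex′
      }

  Fits : Graph n → ℕ → ℕ → Set
  Fits {n} G b m = Σ (Vec (Subset n) m) λ X →
                   IsPathDecomposition G X × maxBagSize X ≤ b

  shorten : (G : Graph n) {b : ℕ} → ∀ m → Fits G b m →
            ∃ λ (m′ : Fin (suc n)) → Fits G b (toℕ m′)
  shorten {n} G {b} m F with m ≤? n
  ... | yes m≤n = fromℕ< (s≤s m≤n) ,
                  subst (Fits G b) (sym (Fin.toℕ-fromℕ< (s≤s m≤n))) F
  shorten G zero    F           | no m≰n = contradiction z≤n m≰n
  shorten G (suc m) (X , D , w) | no m≰n = shorten G m
    (Y , isPathDecomposition , ≤-trans (maxBagSize-removeAt X k) w)
    where open DropBag G X (≰⇒> m≰n) D

  fits? : (G : Graph n) → ∀ b → Dec (∃ (Fits G b))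
  fits? G b =
    map′ (λ (m , F) → toℕ m , F) (λ (m , F) → shorten G m F)
      (Fin.any? λ m → anyVec? (toℕ m) λ X →
         isPathDecomposition? G X ×-dec maxBagSize X ≤? b)

  fits-order : (G : Graph n) → Fits G n 1
  fits-order {n} G = ⊤ ∷ [] , record
    { vertices = λ _ → 0F , ∈⊤
    ; edges    = λ _ _ _ → 0F , ∈⊤ , ∈⊤
    ; convex   = λ { 0F 0F 0F _ _ → p∩q⊆p ⊤ ⊤ }
    } , ⊔-lub (∣p∣≤n (⊤ {n})) z≤n

-- Opaque, so that the search is never unfolded: everything about the value
-- follows from its being the minimum.

opaque

  pathwidth-exists : (G : Graph n) → ∃ (IsLeast ℤ._≤_ (HasWidth G))
  pathwidth-exists {n} G with least (fits? G) n (1 , fits-order G)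
  ... | b , (_ , X , D , w≤b) , b≤ =
    maxBagSize X ⊖ 1 ,
    (record { bags = X ; isPathDecomposition = D } , refl) ,
    λ { (E , refl) → ℤ.⊖-monoˡ-≤ 1 (≤-trans w≤b
          (b≤ (_ , PathDecomposition.bags E ,
                   PathDecomposition.isPathDecomposition E , ≤-refl))) }

pathwidth : Graph n → ℤ
pathwidth G = proj₁ (pathwidth-exists G)

pathwidth-isLeast : (G : Graph n) → IsLeast ℤ._≤_ (HasWidth G) (pathwidth G)
pathwidth-isLeast G = proj₂ (pathwidth-exists G)

HasInducedPathwidth≤2 : Graph n → ℕ → Set
HasInducedPathwidth≤2 {n} G k =
  Σ (Subset n) λ S → ∣ S ∣ ≡ k × pathwidth (G [ S ]) ℤ.≤ + 2

private
  pathwidth<order : (G : Graph n) → pathwidth G ℤ.≤ n ⊖ 1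
  pathwidth<order G = ℤ.≤-trans
    (proj₂ (pathwidth-isLeast G) (D , refl))
    (ℤ.⊖-monoˡ-≤ 1 (proj₂ (proj₂ (fits-order G))))
    where
    D : PathDecomposition G
    D = record { bags                = proj₁ (fits-order G)
               ; isPathDecomposition = proj₁ (proj₂ (fits-order G)) }

opaque

  I₂-exists : (G : Graph n) → ∃ (IsGreatest _≤_ (HasInducedPathwidth≤2 G))
  I₂-exists {n} G =
    greatest
      (λ k → anySubset? λ S → ∣ S ∣ ≟ k ×-dec pathwidth (G [ S ]) ℤ.≤? + 2)
      n (λ { (S , refl , _) → ∣p∣≤n S })
      (∣ ⊥ {n} ∣ , ⊥ , refl ,
        ℤ.≤-trans (pathwidth<order (G [ ⊥ ])) (ℤ.⊖-monoˡ-≤ 1 ∣⊥∣≤3))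
    where
    ∣⊥∣≤3 : ∣ ⊥ {n} ∣ ≤ 3
    ∣⊥∣≤3 = ≤-trans (≤-reflexive (∣⊥∣≡0 n)) z≤n

I₂ : Graph n → ℕ
I₂ G = proj₁ (I₂-exists G)

I₂-isGreatest : (G : Graph n) →
                IsGreatest _≤_ (HasInducedPathwidth≤2 G) (I₂ G)
I₂-isGreatest G = proj₂ (I₂-exists G)

{-# OPTIONS --safe #-}
-- Deleting the two ends u, v of a chord frees the vertices H strictly between
-- them, so (for n ≥ 7) it suffices to find such a chord with at least five
-- vertices in H and pathwidth at most 2 on H, and to recurse on the vertices
-- outside it.
-- Choose H minimal.  If w is the apex of the triangle on uv inside H, then by
-- minimality at most four vertices lie between u and w, and at most four
-- between w and v.  The triangulation of a pentagon is a fan, in which each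
-- corner lies in the first or the last triangle; so each of the two sides,
-- together with w, has a path decomposition of width 2 with w in an end bag,
-- and the two decompositions can be concatenated at w.
module Submission where

open import Defs
open import Data.Bool.Base using (true; false)
open import Data.Fin.Base as Fin using (Fin; zero; suc)
import Data.Fin.Properties as Fin
open import Data.Fin.Permutation using (inverseʳ; _⟨$⟩ˡ_)
open import Data.Fin.Subset as Subset using (Subset; ∣_∣)
open import Data.Fin.Subset.Properties using (x∈p∩q⁻)
import Data.Integer.Properties as ℤ
open import Data.List.Base as List using (List; []; _∷_; _++_; length; tabulate)
open import Data.List.Membership.Propositional using (_∈_)
open import Data.List.Membership.Propositional.Properties
  using (∈-++⁺ˡ; ∈-++⁺ʳ; ∈-++⁻; ∈-lookup)
open import Data.List.Membership.Setoid.Properties using (index-injective)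
open import Data.List.Properties using (length-++; length-tabulate; ++-assoc)
open import Data.List.Relation.Binary.Subset.Propositional using (_⊆_)
open import Data.List.Relation.Unary.All as All using (All; []; _∷_)
import Data.List.Relation.Unary.All.Properties as All
open import Data.List.Relation.Unary.AllPairs as AllPairs using (AllPairs; []; _∷_)
import Data.List.Relation.Unary.AllPairs.Properties as AllPairs
open import Data.List.Relation.Unary.Any as Any using (Any; here; there)
import Data.List.Relation.Unary.Any.Properties as Any
open import Data.List.Relation.Unary.Unique.Propositional using (Unique)
import Data.List.Relation.Unary.Unique.Propositional.Properties as Unique
open import Data.Nat.Base
  using (ℕ; zero; suc; _+_; _*_; _≤_; _≥_; z≤n; s≤s; s≤s⁻¹)
open import Data.Nat.Properties
open import Data.Nat.Tactic.RingSolver using (solve-∀)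
open import Data.Product.Base using (Σ; ∃; _×_; _,_; proj₁; proj₂)
open import Data.Sum.Base as Sum using (_⊎_; inj₁; inj₂; [_,_]′)
open import Data.Unit.Polymorphic.Base using (⊤; tt)
open import Data.Vec.Base as Vec using (Vec; lookup; fromList)
open import Data.Vec.Properties
  using (lookup-map; lookup∘tabulate; []=⇒lookup; lookup⇒[]=)
open import Function.Base using (_∘_; id; case_of_)
open import Function.Definitions using (Injective)
open import Relation.Binary.Core using (Rel)
open import Relation.Binary.PropositionalEquality
  using (_≡_; _≢_; refl; sym; trans; cong; subst; subst₂; setoid)
open import Relation.Nullary.Decidable using (yes; no; does)
open import Relation.Nullary.Negation using (¬_; contradiction)
import Relation.Unary as U

private
  variable
    n : ℕ

-- Lists: related pairs and absence of repetitions.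

module _ {a} {A : Set a} where

  AllPairs-++⁻ : ∀ {ℓ} {R : Rel A ℓ} xs {ys} → AllPairs R (xs ++ ys) →
                 AllPairs R xs × AllPairs R ys ×
                 (∀ {x y} → x ∈ xs → y ∈ ys → R x y)
  AllPairs-++⁻ []       rs       = [] , rs , λ ()
  AllPairs-++⁻ (x ∷ xs) (r ∷ rs) with AllPairs-++⁻ xs rs
  ... | rxs , rys , across =
    All.++⁻ˡ xs r ∷ rxs , rys , λ
      { (here refl) y∈ → All.lookup (All.++⁻ʳ xs r) y∈
      ; (there x∈)  y∈ → across x∈ y∈ }

  lookup-injective : ∀ {xs : List A} → Unique xs → Injective _≡_ _≡_ (List.lookup xs)
  lookup-injective (_ ∷ _)  {zero}  {zero}  _  = refl
  lookup-injective (x∉ ∷ _) {zero}  {suc j} eq =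
    contradiction eq (All.lookup x∉ (∈-lookup j))
  lookup-injective (x∉ ∷ _) {suc i} {zero}  eq =
    contradiction (sym eq) (All.lookup x∉ (∈-lookup i))
  lookup-injective (_ ∷ u)  {suc i} {suc j} eq = cong suc (lookup-injective u eq)

-- Subsets of the vertices and the enumeration of their members.

fromDec : ∀ {p} {P : U.Pred (Fin n) p} → U.Decidable P → Subset n
fromDec P? = Vec.tabulate (does ∘ P?)

module _ {p} {P : U.Pred (Fin n) p} (P? : U.Decidable P) where

  ∈-fromDec⁺ : ∀ {i} → P i → i Subset.∈ fromDec P?
  ∈-fromDec⁺ {i} pi = lookup⇒[]= i _ (trans (lookup∘tabulate _ i) does≡true)
    where
    does≡true : does (P? i) ≡ true
    does≡true with P? i
    ... | yes _  = refl
    ... | no ¬pi = contradiction pi ¬pi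

  ∈-fromDec⁻ : ∀ {i} → i Subset.∈ fromDec P? → P i
  ∈-fromDec⁻ {i} i∈ with P? i | trans (sym (lookup∘tabulate (does ∘ P?) i)) ([]=⇒lookup i∈)
  ... | yes pi | _ = pi

-- Agrees by computation with the vertex map inside `G [ S ]`, so an edge of `G [ S ]` is an edge
-- between members without any conversion.
member : (S : Subset n) → Fin ∣ S ∣ → Fin n
member S = lookup (elements S)

member-true : (S : Subset n) (i : Fin ∣ S ∣) →
              member (true Vec.∷ S) (suc i) ≡ suc (member S i)
member-true S i = lookup-map i suc (elements S)

member-false : (S : Subset n) (i : Fin ∣ S ∣) →
               member (false Vec.∷ S) i ≡ suc (member S i)
member-false S i = lookup-map i suc (elements S)

member-∈ : (S : Subset n) (i : Fin ∣ S ∣) → member S i Subset.∈ S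
member-∈ (true Vec.∷ S)  zero    = Vec.here
member-∈ (true Vec.∷ S)  (suc i) =
  subst (Subset._∈ (true Vec.∷ S)) (sym (member-true S i)) (Vec.there (member-∈ S i))
member-∈ (false Vec.∷ S) i       =
  subst (Subset._∈ (false Vec.∷ S)) (sym (member-false S i)) (Vec.there (member-∈ S i))

member-injective : (S : Subset n) → Injective _≡_ _≡_ (member S)
member-injective (true Vec.∷ S) {zero}  {zero}  _  = refl
member-injective (true Vec.∷ S) {zero}  {suc j} eq =
  contradiction (trans eq (member-true S j)) λ ()
member-injective (true Vec.∷ S) {suc i} {zero}  eq =
  contradiction (trans (sym eq) (member-true S i)) λ ()
member-injective (true Vec.∷ S) {suc i} {suc j} eq =
  cong suc (member-injective S (Fin.suc-injective
    (trans (sym (member-true S i)) (trans eq (member-true S j)))))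
member-injective (false Vec.∷ S) {i} {j} eq =
  member-injective S (Fin.suc-injective
    (trans (sym (member-false S i)) (trans eq (member-false S j))))

member-surjective : (S : Subset n) {x : Fin n} → x Subset.∈ S →
                    ∃ λ i → member S i ≡ x
member-surjective (true Vec.∷ S) Vec.here = zero , refl
member-surjective (true Vec.∷ S) (Vec.there x∈) with member-surjective S x∈
... | i , eq = suc i , trans (member-true S i) (cong suc eq)
member-surjective (false Vec.∷ S) (Vec.there x∈) with member-surjective S x∈
... | i , eq = i , trans (member-false S i) (cong suc eq)

-- The position in `b` of the image of a member is injective in that member. This turns bounds on
-- list bags, which may contain repetitions, into bounds on cardinalities.
∣S∣≤length : ∀ {a} {A : Set a} (S : Subset n) (f : Fin n → A) → Injective _≡_ _≡_ f →
             (b : List A) → (∀ {i} → i Subset.∈ S → f i ∈ b) → ∣ S ∣ ≤ length b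
∣S∣≤length {A = A} S f f-inj b f∈ = Fin.injective⇒≤ λ {i} {j} eq →
  member-injective S (f-inj (index-injective (setoid A) (at i) (at j) eq))
  where
  at : ∀ i → f (member S i) ∈ b
  at i = f∈ (member-∈ S i)

length≤∣S∣ : {L : List (Fin n)} → Unique L → (S : Subset n) →
             (∀ {x} → x ∈ L → x Subset.∈ S) → length L ≤ ∣ S ∣
length≤∣S∣ {L = L} L! S L⊆S = Fin.injective⇒≤ λ {i} {j} eq →
  lookup-injective L!
    (trans (sym (proj₂ (at i))) (trans (cong (member S) eq) (proj₂ (at j))))
  where
  at : ∀ i → ∃ λ k → member S k ≡ List.lookup L i
  at i = member-surjective S (L⊆S (∈-lookup i))

-- Convex sequences of bags.

module _ {a} {A : Set a} where

  _∈∈_ : A → List (List A) → Set a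
  x ∈∈ D = Any (x ∈_) D

  InHead : A → List (List A) → Set a
  InHead x []      = x ∈ []
  InHead x (b ∷ _) = x ∈ b

  InLast : A → List (List A) → Set a
  InLast x []            = x ∈ []
  InLast x (b ∷ [])      = x ∈ b
  InLast x (_ ∷ D@(_ ∷ _)) = InLast x D

  inLast⇒∈∈ : ∀ {x} D → InLast x D → x ∈∈ D
  inLast⇒∈∈ (b ∷ [])      x∈ = here x∈
  inLast⇒∈∈ (b ∷ D@(_ ∷ _)) x∈ = there (inLast⇒∈∈ D x∈)

  -- The convexity axiom of path decompositions, by recursion on the bags.
  Convex : List (List A) → Set a
  Convex []      = ⊤
  Convex (b ∷ D) = (∀ {x} → x ∈ b → x ∈∈ D → InHead x D) × Convex D

  -- A shared element reaches the end of `D` and starts at the beginning of `E`, so its bags stay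
  -- consecutive across the junction.
  convex-++ : ∀ {D E} → Convex D → Convex E →
              (∀ {x} → x ∈∈ D → x ∈∈ E → InLast x D × InHead x E) →
              Convex (D ++ E)
  convex-++ {[]}        _       e _      = e
  convex-++ {b ∷ []}    _       e shared =
    (λ x∈b x∈E → proj₂ (shared (here x∈b) x∈E)) , e
  convex-++ {b ∷ D@(_ ∷ _)} (h , d) e shared =
    -- An element of `b` that recurs in `E` lies in the last bag of `D`, hence occurs in `D`, where
    -- `h` applies.
    (λ x∈b x∈DE → [ h x∈b
                  , (λ x∈E → h x∈b (inLast⇒∈∈ D (proj₁ (shared (here x∈b) x∈E))))
                  ]′ (Any.++⁻ D x∈DE)) ,
    convex-++ {D} d e (shared ∘ there)

  convex-lookup : ∀ D → Convex D → ∀ {x} (i j k : Fin (length D)) →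
                  i Fin.≤ j → j Fin.≤ k →
                  x ∈ lookup (fromList D) i → x ∈ lookup (fromList D) k →
                  x ∈ lookup (fromList D) j
  convex-lookup (b ∷ D) (h , d) zero zero k _ _ x∈i x∈k = x∈i
  convex-lookup (b ∷ D@(_ ∷ _)) (h , d) zero (suc j) (suc k) _ j≤k x∈i x∈k =
    convex-lookup D d zero j k z≤n (s≤s⁻¹ j≤k) (h x∈i (∈∈-lookup D k x∈k)) x∈k
    where
    ∈∈-lookup : ∀ {x} D (k : Fin (length D)) → x ∈ lookup (fromList D) k → x ∈∈ D
    ∈∈-lookup (_ ∷ _) zero    x∈ = here x∈
    ∈∈-lookup (_ ∷ D) (suc k) x∈ = there (∈∈-lookup D k x∈)
  convex-lookup (b ∷ D) (h , d) (suc i) (suc j) (suc k) i≤j j≤k x∈i x∈k =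
    convex-lookup D d i j k (s≤s⁻¹ i≤j) (s≤s⁻¹ j≤k) x∈i x∈k

-- Layouts: path decompositions of width at most 2.

module _ (G : Graph n) where

  open Graph G

  -- Equality is included so that one condition on pairs says both that every vertex and that every
  -- edge lies in a bag.
  Near : Rel (Fin n) _
  Near u v = u ≡ v ⊎ Adj u v

  Near-sym : ∀ {u v} → Near u v → Near v u
  Near-sym = Sum.map sym Adj-sym

  -- A path decomposition of width at most 2 of the subgraph induced by the
  -- members of L.
  record Layout (L : List (Fin n)) : Set where
    field
      bags   : List (List (Fin n))
      small  : All (λ b → length b ≤ 3) bags
      within : ∀ {x} → x ∈∈ bags → x ∈ L
      linked : ∀ {u v} → u ∈ L → v ∈ L → Near u v →
               Any (λ b → u ∈ b × v ∈ b) bags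
      convex : Convex bags

  module _ {L M N : List (Fin n)} (D : Layout L) (E : Layout M) where

    private
      module D = Layout D
      module E = Layout E

    -- `L` and `M` may overlap, but only where the two sequences of bags meet. By the last
    -- hypothesis no edge needs one end from each side, so each is already in a bag of `D` or of
    -- `E`.
    glue : (∀ {x} → x ∈∈ D.bags → x ∈∈ E.bags → InLast x D.bags × InHead x E.bags) →
           L ⊆ N → M ⊆ N → (∀ {x} → x ∈ N → x ∈ L ⊎ x ∈ M) →
           (∀ {u v} → u ∈ L → v ∈ M → Near u v → v ∈ L ⊎ u ∈ M) →
           Layout N
    glue shared L⊆N M⊆N split bridge = record
      { bags   = D.bags ++ E.bags
      ; small  = All.++⁺ D.small E.small
      ; within = [ L⊆N ∘ D.within , M⊆N ∘ E.within ]′ ∘ Any.++⁻ D.bags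
      ; linked = λ u∈ v∈ → link (split u∈) (split v∈)
      ; convex = convex-++ D.convex E.convex shared
      }
      where
      link : ∀ {u v} → u ∈ L ⊎ u ∈ M → v ∈ L ⊎ v ∈ M → Near u v →
             Any (λ b → u ∈ b × v ∈ b) (D.bags ++ E.bags)
      link (inj₁ u∈) (inj₁ v∈) uv = Any.++⁺ˡ (D.linked u∈ v∈ uv)
      link (inj₂ u∈) (inj₂ v∈) uv = Any.++⁺ʳ D.bags (E.linked u∈ v∈ uv)
      link (inj₁ u∈) (inj₂ v∈) uv with bridge u∈ v∈ uv
      ... | inj₁ v∈′ = link (inj₁ u∈) (inj₁ v∈′) uv
      ... | inj₂ u∈′ = link (inj₂ u∈′) (inj₂ v∈) uv
      link (inj₂ u∈) (inj₁ v∈) uv with bridge v∈ u∈ (Near-sym uv)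
      ... | inj₁ u∈′ = link (inj₁ u∈′) (inj₁ v∈) uv
      ... | inj₂ v∈′ = link (inj₂ u∈) (inj₂ v∈′) uv

  layout-++ : ∀ {L M} → Layout L → Layout M →
              (∀ {u v} → u ∈ L → v ∈ M → ¬ Near u v) → Layout (L ++ M)
  layout-++ {L} D E apart =
    glue D E
      (λ x∈D x∈E → contradiction (inj₁ refl)
                     (apart (Layout.within D x∈D) (Layout.within E x∈E)))
      ∈-++⁺ˡ (∈-++⁺ʳ L) (∈-++⁻ L)
      (λ u∈ v∈ uv → contradiction uv (apart u∈ v∈))

  module _ {L : List (Fin n)} (L! : Unique L) (D : Layout L) where

    open Layout D
    open import Data.List.Membership.DecPropositional (Fin._≟_ {n}) using (_∈?_)

    private
      S : Subset n
      S = fromDec (_∈? L)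

      toBag : List (Fin n) → Subset ∣ S ∣
      toBag b = fromDec (λ i → member S i ∈? b)

      X : Vec (Subset ∣ S ∣) (length bags)
      X = Vec.map toBag (fromList bags)

      ∈X⁺ : ∀ i k → member S i ∈ lookup (fromList bags) k → i Subset.∈ lookup X k
      ∈X⁺ i k i∈ = subst (i Subset.∈_) (sym (lookup-map k toBag (fromList bags)))
                     (∈-fromDec⁺ (λ i → member S i ∈? _) i∈)

      ∈X⁻ : ∀ i k → i Subset.∈ lookup X k → member S i ∈ lookup (fromList bags) k
      ∈X⁻ i k i∈ = ∈-fromDec⁻ (λ i → member S i ∈? _)
                     (subst (i Subset.∈_) (lookup-map k toBag (fromList bags)) i∈)

      member-∈L : ∀ i → member S i ∈ L
      member-∈L i = ∈-fromDec⁻ (_∈? L) (member-∈ S i)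

      common : ∀ {i j} bs → Any (λ b → member S i ∈ b × member S j ∈ b) bs →
               ∃ λ k → member S i ∈ lookup (fromList bs) k ×
                       member S j ∈ lookup (fromList bs) k
      common (_ ∷ _)  (here ij)  = zero , ij
      common (_ ∷ bs) (there ij) with common bs ij
      ... | k , ij′ = suc k , ij′

      linkedX : ∀ i j → Near (member S i) (member S j) →
                ∃ λ k → i Subset.∈ lookup X k × j Subset.∈ lookup X k
      linkedX i j ij with common bags (linked (member-∈L i) (member-∈L j) ij)
      ... | k , i∈ , j∈ = k , ∈X⁺ i k i∈ , ∈X⁺ j k j∈

      maxBagSize≤3 : ∀ bs → All (λ b → length b ≤ 3) bs →
                     maxBagSize (Vec.map toBag (fromList bs)) ≤ 3
      maxBagSize≤3 []       []       = z≤n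
      maxBagSize≤3 (b ∷ bs) (p ∷ ps) = ⊔-lub
        (≤-trans (∣S∣≤length (toBag b) (member S) (member-injective S) b
                   (∈-fromDec⁻ (λ i → member S i ∈? b))) p)
        (maxBagSize≤3 bs ps)

      decomposition : PathDecomposition (G [ S ])
      decomposition = record
        { bags = X
        ; isPathDecomposition = record
          { vertices = λ i → case linkedX i i (inj₁ refl) of λ (k , i∈ , _) → k , i∈
          ; edges    = λ i j ij → linkedX i j (inj₂ ij)
          ; convex   = λ i j k i≤j j≤k {x} x∈ →
              case x∈p∩q⁻ (lookup X i) (lookup X k) x∈ of λ (x∈i , x∈k) →
              ∈X⁺ x j (convex-lookup bags convex i j k i≤j j≤k (∈X⁻ x i x∈i) (∈X⁻ x k x∈k))
          }
        }

    -- Rewritten in the indices of `G [ S ]`, the bags form a path decomposition with at most three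
    -- vertices in each, so `G [ S ]` has pathwidth at most 2; `I₂ G` is the greatest order of such
    -- a subgraph.
    length≤I₂ : length L ≤ I₂ G
    length≤I₂ = ≤-trans
      (length≤∣S∣ L! S (∈-fromDec⁺ (_∈? L)))
      (proj₂ (I₂-isGreatest G)
        (S , refl , ℤ.≤-trans (proj₂ (pathwidth-isLeast (G [ S ])) (decomposition , refl))
                              (ℤ.⊖-monoˡ-≤ 1 (maxBagSize≤3 bags small))))

  -- Strips: decompositions of at most five vertices with a prescribed vertex at one end.

  pattern 0th p = here p
  pattern 1st p = there (here p)
  pattern 2nd p = there (there (here p))
  pattern 3rd p = there (there (there (here p)))
  pattern 4th p = there (there (there (there (here p))))

  -- Three bags suffice for five vertices; they are kept separate so that
  -- their order can be reversed.
  record Strip (w : Fin n) (L : List (Fin n)) : Set where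
    field
      b₁ b₂ b₃ : List (Fin n)
    strip : List (List (Fin n))
    strip = b₁ ∷ b₂ ∷ b₃ ∷ []
    field
      small  : All (λ b → length b ≤ 3) strip
      within : ∀ {x} → x ∈∈ strip → x ∈ L
      linked : ∀ {u v} → u ∈ L → v ∈ L → Near u v →
               Any (λ b → u ∈ b × v ∈ b) strip
      meet   : ∀ {x} → x ∈ b₁ → x ∈ b₃ → x ∈ b₂
      w∈b₃   : w ∈ b₃

  strip-layout : ∀ {w L} → Strip w L → Layout L
  strip-layout s = record
    { bags   = strip
    ; small  = small
    ; within = within
    ; linked = linked
    ; convex = (λ { x∈ (0th p) → p ; x∈ (1st p) → meet x∈ p }) ,
               (λ { x∈ (0th p) → p }) , (λ _ ()) , tt
    }
    where open Strip s

  -- `meet` is symmetric in the outer bags, so reversal keeps convexity; it moves `w` from the last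
  -- bag to the first.
  reversed-strip-layout : ∀ {w L} → Strip w L → Layout L
  reversed-strip-layout s = record
    { bags   = b₃ ∷ b₂ ∷ b₁ ∷ []
    ; small  = case small of λ { (p ∷ q ∷ r ∷ []) → r ∷ q ∷ p ∷ [] }
    ; within = λ x∈ → within (reverse x∈)
    ; linked = λ u∈ v∈ uv → reverse (linked u∈ v∈ uv)
    ; convex = (λ { x∈ (0th p) → p ; x∈ (1st p) → meet p x∈ }) ,
               (λ { x∈ (0th p) → p }) , (λ _ ()) , tt
    }
    where
    open Strip s
    reverse : ∀ {p} {P : U.Pred (List (Fin n)) p} {b₁ b₂ b₃} →
              Any P (b₁ ∷ b₂ ∷ b₃ ∷ []) → Any P (b₃ ∷ b₂ ∷ b₁ ∷ [])
    reverse (0th p) = 2nd p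
    reverse (1st p) = 1st p
    reverse (2nd p) = 0th p

  ≤3-strip : ∀ {w L} → length L ≤ 3 → w ∈ L → Strip w L
  ≤3-strip {w} {L} L≤3 w∈ = record
    { b₁ = L ; b₂ = L ; b₃ = L
    ; small  = L≤3 ∷ L≤3 ∷ L≤3 ∷ []
    ; within = λ { (0th p) → p ; (1st p) → p ; (2nd p) → p }
    ; linked = λ u∈ v∈ _ → here (u∈ , v∈)
    ; meet   = λ x∈ _ → x∈
    ; w∈b₃   = w∈
    }

  -- Four vertices with one pair `x`, `t` not joined fit into two triangles on the common side
  -- `y z`. The second triangle is repeated to fill the third bag.
  two-triangles : ∀ {w L} x y z t → All (_∈ L) (x ∷ y ∷ z ∷ t ∷ []) →
                  All (_∈ x ∷ y ∷ z ∷ t ∷ []) L →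
                  ¬ Adj x t → w ∈ y ∷ z ∷ t ∷ [] → Strip w L
  two-triangles {w} {L} x y z t (x∈ ∷ y∈ ∷ z∈ ∷ t∈ ∷ []) L⊆ ¬xt w∈ = record
    { b₁ = x ∷ y ∷ z ∷ []
    ; b₂ = y ∷ z ∷ t ∷ []
    ; b₃ = y ∷ z ∷ t ∷ []
    ; small  = ≤-refl ∷ ≤-refl ∷ ≤-refl ∷ []
    ; within = λ { (0th p) → All.lookup (x∈ ∷ y∈ ∷ z∈ ∷ []) p
                 ; (1st p) → All.lookup (y∈ ∷ z∈ ∷ t∈ ∷ []) p
                 ; (2nd p) → All.lookup (y∈ ∷ z∈ ∷ t∈ ∷ []) p }
    ; linked = λ u∈ v∈ → link (All.lookup L⊆ u∈) (All.lookup L⊆ v∈)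
    ; meet   = λ _ p → p
    ; w∈b₃   = w∈
    }
    where
    link : ∀ {u v} → u ∈ x ∷ y ∷ z ∷ t ∷ [] → v ∈ x ∷ y ∷ z ∷ t ∷ [] → Near u v →
           Any (λ b → u ∈ b × v ∈ b)
               ((x ∷ y ∷ z ∷ []) ∷ (y ∷ z ∷ t ∷ []) ∷ (y ∷ z ∷ t ∷ []) ∷ [])
    link (there p) (there q) _ = 1st (p , q)
    link (0th p) (0th q) _ = 0th (0th p , 0th q)
    link (0th p) (1st q) _ = 0th (0th p , 1st q)
    link (0th p) (2nd q) _ = 0th (0th p , 2nd q)
    link (1st p) (0th q) _ = 0th (1st p , 0th q)
    link (2nd p) (0th q) _ = 0th (2nd p , 0th q)
    -- The four names may coincide: if `x` is `t`, the bag of `t` holds both.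
    link (0th refl) (3rd refl) (inj₁ refl) = 1st (2nd refl , 2nd refl)
    link (0th refl) (3rd refl) (inj₂ xt) = contradiction xt ¬xt
    link (3rd refl) (0th refl) (inj₁ refl) = 1st (2nd refl , 2nd refl)
    link (3rd refl) (0th refl) (inj₂ tx) = contradiction (Adj-sym tx) ¬xt

  -- The bags are the triangles from the centre `a` to the successive sides of the path
  -- `x₁ x₂ x₃ x₄`; the excluded edges are the diagonals of the pentagon that miss `a`. Were `x₁`
  -- equal to `x₄`, it would lie in both outer bags and possibly not in the middle one.
  fan : ∀ {w L} a x₁ x₂ x₃ x₄ → All (_∈ L) (a ∷ x₁ ∷ x₂ ∷ x₃ ∷ x₄ ∷ []) →
        All (_∈ a ∷ x₁ ∷ x₂ ∷ x₃ ∷ x₄ ∷ []) L →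
        x₁ ≢ x₄ → ¬ Adj x₁ x₃ → ¬ Adj x₁ x₄ → ¬ Adj x₂ x₄ →
        w ∈ a ∷ x₃ ∷ x₄ ∷ [] → Strip w L
  fan {w} {L} a x₁ x₂ x₃ x₄ (a∈ ∷ x₁∈ ∷ x₂∈ ∷ x₃∈ ∷ x₄∈ ∷ []) L⊆ 1≢4 ¬13 ¬14 ¬24 w∈ =
    record
    { b₁ = a ∷ x₁ ∷ x₂ ∷ []
    ; b₂ = a ∷ x₂ ∷ x₃ ∷ []
    ; b₃ = a ∷ x₃ ∷ x₄ ∷ []
    ; small  = ≤-refl ∷ ≤-refl ∷ ≤-refl ∷ []
    ; within = λ { (0th p) → All.lookup (a∈ ∷ x₁∈ ∷ x₂∈ ∷ []) p
                 ; (1st p) → All.lookup (a∈ ∷ x₂∈ ∷ x₃∈ ∷ []) p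
                 ; (2nd p) → All.lookup (a∈ ∷ x₃∈ ∷ x₄∈ ∷ []) p }
    ; linked = λ u∈ v∈ → link (All.lookup L⊆ u∈) (All.lookup L⊆ v∈)
    ; meet   = λ { (0th p) _ → 0th p
                 ; (1st p) (0th q) → 0th q
                 ; (1st p) (1st q) → 2nd q
                 ; (1st refl) (2nd refl) → contradiction refl 1≢4
                 ; (2nd p) _ → 1st p }
    ; w∈b₃   = w∈
    }
    where
    F = a ∷ x₁ ∷ x₂ ∷ x₃ ∷ x₄ ∷ []
    T : Rel (Fin n) _
    T u v = Any (λ b → u ∈ b × v ∈ b)
                ((a ∷ x₁ ∷ x₂ ∷ []) ∷ (a ∷ x₂ ∷ x₃ ∷ []) ∷ (a ∷ x₃ ∷ x₄ ∷ []) ∷ [])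
    link : ∀ {u v} → u ∈ F → v ∈ F → Near u v → T u v
    link (0th p) (0th q) _ = 0th (0th p , 0th q)
    link (0th p) (1st q) _ = 0th (0th p , 1st q)
    link (0th p) (2nd q) _ = 0th (0th p , 2nd q)
    link (0th p) (3rd q) _ = 2nd (0th p , 1st q)
    link (0th p) (4th q) _ = 2nd (0th p , 2nd q)
    link (1st p) (0th q) _ = 0th (1st p , 0th q)
    link (1st p) (1st q) _ = 0th (1st p , 1st q)
    link (1st p) (2nd q) _ = 0th (1st p , 2nd q)
    link (2nd p) (0th q) _ = 0th (2nd p , 0th q)
    link (2nd p) (1st q) _ = 0th (2nd p , 1st q)
    link (2nd p) (2nd q) _ = 0th (2nd p , 2nd q)
    link (2nd p) (3rd q) _ = 1st (1st p , 2nd q)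
    link (3rd p) (0th q) _ = 2nd (1st p , 0th q)
    link (3rd p) (2nd q) _ = 1st (2nd p , 1st q)
    link (3rd p) (3rd q) _ = 2nd (1st p , 1st q)
    link (3rd p) (4th q) _ = 2nd (1st p , 2nd q)
    link (4th p) (0th q) _ = 2nd (2nd p , 0th q)
    link (4th p) (3rd q) _ = 2nd (2nd p , 1st q)
    link (4th p) (4th q) _ = 2nd (2nd p , 2nd q)
    link (1st refl) (3rd refl) (inj₁ refl) = 1st (2nd refl , 2nd refl)
    link (3rd refl) (1st refl) (inj₁ refl) = 1st (2nd refl , 2nd refl)
    link (1st refl) (4th refl) (inj₁ refl) = contradiction refl 1≢4
    link (4th refl) (1st refl) (inj₁ refl) = contradiction refl 1≢4
    link (2nd refl) (4th refl) (inj₁ refl) = 1st (1st refl , 1st refl)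
    link (4th refl) (2nd refl) (inj₁ refl) = 1st (1st refl , 1st refl)
    link (1st refl) (3rd refl) (inj₂ uv) = contradiction uv ¬13
    link (3rd refl) (1st refl) (inj₂ uv) = contradiction (Adj-sym uv) ¬13
    link (1st refl) (4th refl) (inj₂ uv) = contradiction uv ¬14
    link (4th refl) (1st refl) (inj₂ uv) = contradiction (Adj-sym uv) ¬14
    link (2nd refl) (4th refl) (inj₂ uv) = contradiction uv ¬24
    link (4th refl) (2nd refl) (inj₂ uv) = contradiction (Adj-sym uv) ¬24

  -- Pentagons, apexes and cuts in an outerplanar drawing.

  module _ (drawing : OuterplanarDrawing G) where

    open OuterplanarDrawing drawing

    infix 4 _⊏_

    _⊏_ : Rel (Fin n) _
    u ⊏ v = pos u Fin.< pos v

    ⊏⇒≢ : ∀ {u v} → u ⊏ v → u ≢ v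
    ⊏⇒≢ u⊏u refl = <-irrefl refl u⊏u

    Sorted : List (Fin n) → Set
    Sorted = AllPairs _⊏_

    uncrossed : ∀ {a c b d} → a ⊏ c → c ⊏ b → b ⊏ d → Adj a b → ¬ Adj c d
    uncrossed ac cb bd ab cd = noncrossing ab cd (ac , cb , bd)

    -- The last hypothesis treats `w` before `A` and `w` after `A` at once: in both cases a chord of
    -- `A` separates the vertices between its ends from `w`.
    pentagon : ∀ {w A} → Sorted A → length A ≤ 4 → (∀ {x} → x ∈ A → x ≢ w) →
               (∀ {x y z} → x ∈ A → z ∈ A → x ⊏ y → y ⊏ z → Adj x z → ¬ Adj y w) →
               Strip w (w ∷ A)
    pentagon {A = []}             _ _ _ _ = ≤3-strip (s≤s z≤n) (0th refl)
    pentagon {A = _ ∷ []}         _ _ _ _ = ≤3-strip (s≤s (s≤s z≤n)) (0th refl)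
    pentagon {A = _ ∷ _ ∷ []}     _ _ _ _ = ≤3-strip ≤-refl (0th refl)
    -- If `p₁ p₃` is an edge, it separates `p₂` from `w`; otherwise it is itself the pair that is
    -- not joined.
    pentagon {w} {p₁ ∷ p₂ ∷ p₃ ∷ []} ((12< ∷ _) ∷ (23< ∷ []) ∷ _) _ _ ¬w
      with Adj? p₁ p₃
    ... | yes e13 = two-triangles p₂ p₁ p₃ w
      (2nd refl ∷ 1st refl ∷ 3rd refl ∷ 0th refl ∷ [])
      (3rd refl ∷ 1st refl ∷ 0th refl ∷ 2nd refl ∷ [])
      (¬w (0th refl) (2nd refl) 12< 23< e13) (2nd refl)
    ... | no ¬13 = two-triangles p₁ w p₂ p₃
      (1st refl ∷ 0th refl ∷ 2nd refl ∷ 3rd refl ∷ [])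
      (1st refl ∷ 0th refl ∷ 2nd refl ∷ 3rd refl ∷ [])
      ¬13 (0th refl)
    -- Each case takes as centre a corner of the pentagon `p₁ p₂ p₃ p₄ w` such that the three
    -- diagonals missing it are absent, either by test or because they would cross an edge found.
    -- The path is directed so that `w` lies in the last triangle.
    pentagon {w} {p₁ ∷ p₂ ∷ p₃ ∷ p₄ ∷ []}
             ((12< ∷ 13< ∷ 14< ∷ []) ∷ (23< ∷ 24< ∷ []) ∷ (34< ∷ []) ∷ _) _ ≢w ¬w
      with Adj? p₁ p₃ | Adj? p₂ p₄ | Adj? p₁ p₄ | Adj? p₃ w
    ... | yes e13 | _      | _      | yes e3w = fan p₃ p₂ p₁ w p₄
      (3rd refl ∷ 2nd refl ∷ 1st refl ∷ 0th refl ∷ 4th refl ∷ [])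
      (3rd refl ∷ 2nd refl ∷ 1st refl ∷ 0th refl ∷ 4th refl ∷ [])
      (⊏⇒≢ 24<) (¬w (0th refl) (2nd refl) 12< 23< e13) (uncrossed 12< 23< 34< e13)
      (λ e14 → ¬w (0th refl) (3rd refl) 13< 34< e14 e3w) (1st refl)
    ... | yes e13 | _      | _      | no ¬3w = fan p₁ p₂ p₃ p₄ w
      (1st refl ∷ 2nd refl ∷ 3rd refl ∷ 4th refl ∷ 0th refl ∷ [])
      (4th refl ∷ 0th refl ∷ 1st refl ∷ 2nd refl ∷ 3rd refl ∷ [])
      (≢w (1st refl)) (uncrossed 12< 23< 34< e13)
      (¬w (0th refl) (2nd refl) 12< 23< e13) ¬3w (2nd refl)
    ... | no ¬13 | yes e24 | yes e14 | _      = fan p₄ p₃ p₂ p₁ w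
      (4th refl ∷ 3rd refl ∷ 2nd refl ∷ 1st refl ∷ 0th refl ∷ [])
      (4th refl ∷ 3rd refl ∷ 2nd refl ∷ 1st refl ∷ 0th refl ∷ [])
      (≢w (2nd refl)) (¬13 ∘ Adj-sym) (¬w (1st refl) (3rd refl) 23< 34< e24)
      (¬w (0th refl) (3rd refl) 12< 24< e14) (2nd refl)
    ... | no ¬13 | yes e24 | no ¬14 | _      = fan p₂ p₃ p₄ w p₁
      (2nd refl ∷ 3rd refl ∷ 4th refl ∷ 0th refl ∷ 1st refl ∷ [])
      (3rd refl ∷ 4th refl ∷ 0th refl ∷ 1st refl ∷ 2nd refl ∷ [])
      (⊏⇒≢ 13< ∘ sym) (¬w (1st refl) (3rd refl) 23< 34< e24) (¬13 ∘ Adj-sym)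
      (¬14 ∘ Adj-sym) (1st refl)
    ... | no ¬13 | no ¬24 | yes e14 | _      = fan p₁ p₂ p₃ p₄ w
      (1st refl ∷ 2nd refl ∷ 3rd refl ∷ 4th refl ∷ 0th refl ∷ [])
      (4th refl ∷ 0th refl ∷ 1st refl ∷ 2nd refl ∷ 3rd refl ∷ [])
      (≢w (1st refl)) ¬24 (¬w (0th refl) (3rd refl) 12< 24< e14)
      (¬w (0th refl) (3rd refl) 13< 34< e14) (2nd refl)
    ... | no ¬13 | no ¬24 | no ¬14 | _      = fan w p₁ p₂ p₃ p₄
      (0th refl ∷ 1st refl ∷ 2nd refl ∷ 3rd refl ∷ 4th refl ∷ [])
      (0th refl ∷ 1st refl ∷ 2nd refl ∷ 3rd refl ∷ 4th refl ∷ [])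
      (⊏⇒≢ 14<) ¬13 ¬14 ¬24 (0th refl)
    pentagon {A = _ ∷ _ ∷ _ ∷ _ ∷ _ ∷ _} _ (s≤s (s≤s (s≤s (s≤s ())))) _ _

    pentagonʳ : ∀ {w A} → Sorted A → length A ≤ 4 → (∀ {x} → x ∈ A → x ⊏ w) →
                Strip w (w ∷ A)
    pentagonʳ A↗ A≤4 A⊏w = pentagon A↗ A≤4 (⊏⇒≢ ∘ A⊏w)
      (λ _ z∈ xy yz → uncrossed xy yz (A⊏w z∈))

    pentagonˡ : ∀ {w A} → Sorted A → length A ≤ 4 → (∀ {x} → x ∈ A → w ⊏ x) →
                Strip w (w ∷ A)
    pentagonˡ A↗ A≤4 w⊏A = pentagon A↗ A≤4 (λ x∈ → ⊏⇒≢ (w⊏A x∈) ∘ sym)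
      (λ x∈ _ xy yz xz yw → uncrossed (w⊏A x∈) xy yz (Adj-sym yw) xz)

    -- The last neighbour w of u in H, or the first vertex of H if there is no
    -- neighbour: in a maximal outerplanar graph with uv an edge, the apex of
    -- the triangle on the side of uv where H lies.
    record Apex (u : Fin n) (H : List (Fin n)) : Set where
      constructor apex
      field
        {A}   : List (Fin n)
        w     : Fin n
        {B}   : List (Fin n)
        eq    : H ≡ A ++ w ∷ B
        u~w   : A ≡ [] ⊎ Adj u w
        ¬u~B  : ∀ {b} → b ∈ B → ¬ Adj u b

    findApex : ∀ u H → 1 ≤ length H → Apex u H
    findApex u (h ∷ [])         _ = apex {A = []} h refl (inj₁ refl) λ ()
    findApex u (h ∷ H@(_ ∷ _)) _ with findApex u H (s≤s z≤n)
    ... | apex {A} w eq (inj₂ uw) ¬uB = apex {A = h ∷ A} w (cong (h ∷_) eq) (inj₂ uw) ¬uB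
    -- Here `w` is the first vertex of the tail and was chosen only by default. It stays if it is a
    -- neighbour of `u`; if not, the default moves to `h`.
    ... | apex w refl (inj₁ refl) ¬uB with Adj? u w
    ...   | yes uw = apex {A = h ∷ []} w refl (inj₂ uw) ¬uB
    ...   | no ¬uw = apex {A = []} h refl (inj₁ refl) λ
              { (here refl) → ¬uw ; (there b∈) → ¬uB b∈ }

    -- The chord `u v` need not be an edge of `G`. What is recorded is the separation such a chord
    -- would give: without `u` and `v`, no edge leaves `H` within `xs`.
    record Cut (xs : List (Fin n)) : Set where
      constructor cut
      field
        ps     : List (Fin n)
        u      : Fin n
        H      : List (Fin n)
        v      : Fin n
        qs     : List (Fin n)
        eq     : xs ≡ ps ++ u ∷ H ++ v ∷ qs
        closed : ∀ {h z} → h ∈ H → z ∈ ps ++ qs → ¬ Adj h z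
        5≤H    : 5 ≤ length H

    -- Splitting a cut at its apex.

    module Split (ps : List (Fin n)) (u : Fin n) (A : List (Fin n)) (w : Fin n)
                 (B : List (Fin n)) (v : Fin n) (qs : List (Fin n))
                 (sorted : Sorted (ps ++ u ∷ A ++ w ∷ B ++ v ∷ qs))
                 (closed : ∀ {h z} → h ∈ A ++ w ∷ B → z ∈ ps ++ qs → ¬ Adj h z)
                 (u~w : A ≡ [] ⊎ Adj u w) (¬u~B : ∀ {b} → b ∈ B → ¬ Adj u b) where

      private
        uABv = proj₁ (proj₂ (AllPairs-++⁻ ps sorted))
        u⊏   = AllPairs.head uABv
        A-wB = AllPairs-++⁻ A (AllPairs.tail uABv)
        w⊏   = AllPairs.head (proj₁ (proj₂ A-wB))
        Bv   = AllPairs-++⁻ B (AllPairs.tail (proj₁ (proj₂ A-wB)))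

      -- If `A` is nonempty, the edge `u w` passes over it, and an edge from `A` to a vertex after
      -- `w` would cross `u w`.
      A-right : ∀ {a z} → a ∈ A → z ∈ B ++ v ∷ qs → ¬ Adj a z
      A-right a∈ z∈ =
        [ (λ A≡[] → case subst (_ ∈_) A≡[] a∈ of λ ())
        , uncrossed (All.lookup u⊏ (∈-++⁺ˡ a∈))
            (proj₂ (proj₂ A-wB) a∈ (0th refl)) (All.lookup w⊏ z∈)
        ]′ u~w

      A-closed : ∀ {h z} → h ∈ A → z ∈ ps ++ B ++ v ∷ qs → ¬ Adj h z
      A-closed h∈ z∈ with ∈-++⁻ ps z∈
      ... | inj₁ z∈ps = closed (∈-++⁺ˡ h∈) (∈-++⁺ˡ z∈ps)
      ... | inj₂ z∈r  = A-right h∈ z∈r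

      -- The old cut excludes `ps` and `qs`, the choice of `w` as last neighbour excludes `u`, and
      -- `A-right` excludes `A`.
      B-closed : ∀ {h z} → h ∈ B → z ∈ (ps ++ u ∷ A) ++ qs → ¬ Adj h z
      B-closed h∈ z∈ with ∈-++⁻ (ps ++ u ∷ A) z∈
      ... | inj₂ z∈qs = closed (∈-++⁺ʳ A (there h∈)) (∈-++⁺ʳ ps z∈qs)
      ... | inj₁ z∈l with ∈-++⁻ ps z∈l
      ...   | inj₁ z∈ps        = closed (∈-++⁺ʳ A (there h∈)) (∈-++⁺ˡ z∈ps)
      ...   | inj₂ (here refl) = ¬u~B h∈ ∘ Adj-sym
      ...   | inj₂ (there z∈A) = A-right z∈A (∈-++⁺ˡ h∈) ∘ Adj-sym

      -- The two strips share only `w`, and `A-right` leaves no edge between `A` and `B`.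
      layout : length A ≤ 4 → length B ≤ 4 → Layout (A ++ w ∷ B)
      layout A≤4 B≤4 = glue (strip-layout SA) (reversed-strip-layout SB)
        (λ x∈A x∈B → case wA∩wB (Strip.within SA x∈A)
                            (Layout.within (reversed-strip-layout SB) x∈B) of λ
           { refl → Strip.w∈b₃ SA , Strip.w∈b₃ SB })
        (λ { (here refl) → ∈-++⁺ʳ A (here refl) ; (there x∈) → ∈-++⁺ˡ x∈ })
        (∈-++⁺ʳ A)
        (Sum.map₁ there ∘ ∈-++⁻ A)
        λ { _            (here refl) _           → inj₁ (here refl)
          ; (here refl)  _           _           → inj₂ (here refl)
          ; (there u∈)   (there v∈)  (inj₁ refl) →
              contradiction refl (⊏⇒≢ (proj₂ (proj₂ A-wB) u∈ (there (∈-++⁺ˡ v∈))))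
          ; (there u∈)   (there v∈)  (inj₂ uv)   →
              contradiction uv (A-right u∈ (∈-++⁺ˡ v∈)) }
        where
        SA : Strip w (w ∷ A)
        SA = pentagonʳ (proj₁ A-wB) A≤4 (λ a∈ → proj₂ (proj₂ A-wB) a∈ (here refl))
        SB : Strip w (w ∷ B)
        SB = pentagonˡ (proj₁ Bv) B≤4 (λ b∈ → All.lookup w⊏ (∈-++⁺ˡ b∈))
        wA∩wB : ∀ {x} → x ∈ w ∷ A → x ∈ w ∷ B → x ≡ w
        wA∩wB (here refl) _           = refl
        wA∩wB (there _)   (here refl) = refl
        wA∩wB (there a∈)  (there b∈)  =
          contradiction refl (⊏⇒≢ (proj₂ (proj₂ A-wB) a∈ (there (∈-++⁺ˡ b∈))))

    -- Descent stands in for a minimal choice: a side of the apex with five or more vertices is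
    -- again the inside of a cut, and it is shorter because it lacks `w`. The bound `m` makes the
    -- recursion terminate.
    minimalCut : ∀ m {xs} → Sorted xs → (c : Cut xs) → length (Cut.H c) ≤ m →
                 Σ (Cut xs) λ c′ → Layout (Cut.H c′)
    minimalCut zero    _ (cut _ _ _ _ _ _ _ 5≤H) H≤0 = contradiction (≤-trans 5≤H H≤0) λ ()
    minimalCut (suc m) s (cut ps u H v qs refl closed 5≤H) H≤m
      with findApex u H (≤-trans (s≤s z≤n) 5≤H)
    ... | apex {A} w {B} refl u~w ¬u~B = result
      where
      assoc₁ : ps ++ u ∷ (A ++ w ∷ B) ++ v ∷ qs ≡ ps ++ u ∷ A ++ w ∷ B ++ v ∷ qs
      assoc₁ = cong (λ t → ps ++ u ∷ t) (++-assoc A (w ∷ B) (v ∷ qs))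
      assoc₂ : ps ++ u ∷ (A ++ w ∷ B) ++ v ∷ qs ≡ (ps ++ u ∷ A) ++ w ∷ B ++ v ∷ qs
      assoc₂ = trans assoc₁ (sym (++-assoc ps (u ∷ A) _))
      open Split ps u A w B v qs (subst Sorted assoc₁ s) closed u~w ¬u~B
      A+B≤m : length A + length B ≤ m
      A+B≤m = s≤s⁻¹ (≤-trans (≤-reflexive (sym
        (trans (length-++ A) (+-suc (length A) (length B))))) H≤m)
      result : Σ (Cut (ps ++ u ∷ (A ++ w ∷ B) ++ v ∷ qs)) λ c′ → Layout (Cut.H c′)
      result with 5 ≤? length A | 5 ≤? length B
      ... | yes 5≤A | _       =
        minimalCut m s (cut ps u A w (B ++ v ∷ qs) assoc₁ A-closed 5≤A)
                   (m+n≤o⇒m≤o _ A+B≤m)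
      ... | no _    | yes 5≤B =
        minimalCut m s (cut (ps ++ u ∷ A) w B v qs assoc₂ B-closed 5≤B)
                   (m+n≤o⇒n≤o _ A+B≤m)
      ... | no A<5  | no B<5  =
        cut ps u (A ++ w ∷ B) v qs refl closed 5≤H ,
        layout (s≤s⁻¹ (≰⇒> A<5)) (s≤s⁻¹ (≰⇒> B<5))

    -- With the first and last vertices as ends nothing lies outside, so closedness is vacuous; of
    -- seven or more vertices at least five remain inside.
    wholeCut : ∀ x xs → 6 ≤ length xs → Cut (x ∷ xs)
    wholeCut x xs 6≤xs with List.initLast xs
    ... | H List.∷ʳ′ v = cut [] x H v [] refl (λ _ ())
      (s≤s⁻¹ (≤-trans 6≤xs (≤-reflexive (trans (length-++ H) (+-comm (length H) 1)))))

    pentagon-layout : ∀ {x xs} → Sorted (x ∷ xs) → length xs ≤ 4 → Layout (x ∷ xs)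
    pentagon-layout (x⊏ ∷ s) xs≤4 = strip-layout (pentagonˡ s xs≤4 (All.lookup x⊏))

    -- Keeping five sevenths of the vertices.

    record Kept (xs : List (Fin n)) : Set where
      field
        L      : List (Fin n)
        unique : Unique L
        L⊆xs   : L ⊆ xs
        layout : Layout L
        many   : 5 * length xs ≤ 7 * length L

    Sorted⇒Unique : ∀ {xs} → Sorted xs → Unique xs
    Sorted⇒Unique = AllPairs.map ⊏⇒≢

    module Remove (ps : List (Fin n)) (u : Fin n) (H : List (Fin n)) (v : Fin n)
                  (qs : List (Fin n)) (sorted : Sorted (ps ++ u ∷ H ++ v ∷ qs)) where

      private
        p-uHv = AllPairs-++⁻ ps sorted
        H-v   = AllPairs-++⁻ H (AllPairs.tail (proj₁ (proj₂ p-uHv)))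

        ps⊏ : ∀ {p x} → p ∈ ps → x ∈ H ++ v ∷ qs → p ⊏ x
        ps⊏ p∈ x∈ = proj₂ (proj₂ p-uHv) p∈ (there x∈)

      rest-sorted : Sorted (ps ++ qs)
      rest-sorted = AllPairs.++⁺ (proj₁ p-uHv) (AllPairs.tail (proj₁ (proj₂ H-v)))
        (All.tabulate λ p∈ → All.tabulate λ q∈ → ps⊏ p∈ (∈-++⁺ʳ H (there q∈)))

      H-unique : Unique H
      H-unique = Sorted⇒Unique (proj₁ H-v)

      H∩rest : ∀ {h z} → h ∈ H → z ∈ ps ++ qs → h ≢ z
      H∩rest h∈ z∈ with ∈-++⁻ ps z∈
      ... | inj₁ z∈ps = ⊏⇒≢ (ps⊏ z∈ps (∈-++⁺ˡ h∈)) ∘ sym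
      ... | inj₂ z∈qs = ⊏⇒≢ (proj₂ (proj₂ H-v) h∈ (there z∈qs))

      rest⊆ : ps ++ qs ⊆ ps ++ u ∷ H ++ v ∷ qs
      rest⊆ z∈ with ∈-++⁻ ps z∈
      ... | inj₁ z∈ps = ∈-++⁺ˡ z∈ps
      ... | inj₂ z∈qs = ∈-++⁺ʳ ps (there (∈-++⁺ʳ H (there z∈qs)))

      H⊆ : H ⊆ ps ++ u ∷ H ++ v ∷ qs
      H⊆ h∈ = ∈-++⁺ʳ ps (there (∈-++⁺ˡ h∈))

      length-cut : length (ps ++ u ∷ H ++ v ∷ qs) ≡ 2 + length H + length (ps ++ qs)
      length-cut
        rewrite length-++ ps {u ∷ H ++ v ∷ qs} | length-++ H {v ∷ qs} | length-++ ps {qs} =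
        arith (length ps) (length H) (length qs)
        where
        arith : ∀ p h q → p + suc (h + suc q) ≡ 2 + h + (p + q)
        arith = solve-∀

    -- The two deleted ends cost `2 * 5`, which the surplus `2 * h` of the kept inside covers since
    -- `5 ≤ h`.
    keep-count : ∀ {h r k} → 5 ≤ h → 5 * r ≤ 7 * k → 5 * (2 + h + r) ≤ 7 * (h + k)
    keep-count {h} {r} {k} 5≤h 5r≤7k = begin
      5 * (2 + h + r)           ≡⟨ lhs h r ⟩
      2 * 5 + 5 * h + 5 * r     ≤⟨ +-mono-≤ (+-monoˡ-≤ (5 * h) (*-monoʳ-≤ 2 5≤h)) 5r≤7k ⟩
      2 * h + 5 * h + 7 * k     ≡⟨ rhs h k ⟩
      7 * (h + k)               ∎
      where
      open ≤-Reasoning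
      lhs : ∀ h r → 5 * (2 + h + r) ≡ 2 * 5 + 5 * h + 5 * r
      lhs = solve-∀
      rhs : ∀ h k → 2 * h + 5 * h + 7 * k ≡ 7 * (h + k)
      rhs = solve-∀

    drop-count : ∀ {l} → 5 ≤ l → 5 * (1 + l) ≤ 7 * l
    drop-count {l} 5≤l = begin
      5 * (1 + l)      ≡⟨ *-distribˡ-+ 5 1 l ⟩
      5 + 5 * l        ≤⟨ +-monoˡ-≤ (5 * l) (≤-trans 5≤l (m≤n*m l 2)) ⟩
      2 * l + 5 * l    ≡⟨ *-distribʳ-+ l 2 5 ⟨
      7 * l            ∎
      where open ≤-Reasoning

    -- `m` bounds the length so that the recursion on `ps ++ qs`, which is not a sublist by
    -- structure, terminates.
    keep : ∀ m xs → length xs ≤ m → Sorted xs → Kept xs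

    keep-cut : ∀ m {xs} → length xs ≤ suc m → Sorted xs →
               (c : Cut xs) → Layout (Cut.H c) → Kept xs
    keep-cut m xs≤m s (cut ps u H v qs refl closed 5≤H) layoutH = record
      { L      = H ++ K.L
      ; unique = Unique.++⁺ H-unique K.unique
                   λ (h∈ , k∈) → H∩rest h∈ (K.L⊆xs k∈) refl
      ; L⊆xs   = [ H⊆ , rest⊆ ∘ K.L⊆xs ]′ ∘ ∈-++⁻ H
      ; layout = layout-++ layoutH K.layout λ
          { h∈ k∈ (inj₁ eq) → H∩rest h∈ (K.L⊆xs k∈) eq
          ; h∈ k∈ (inj₂ hk) → closed h∈ (K.L⊆xs k∈) hk }
      ; many   = subst (5 * length (ps ++ u ∷ H ++ v ∷ qs) ≤_)
                   (cong (7 *_) (sym (length-++ H)))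
                   (subst (λ l → 5 * l ≤ 7 * (length H + length K.L)) (sym length-cut)
                     (keep-count 5≤H K.many))
      }
      where
      open Remove ps u H v qs s
      rest≤m : length (ps ++ qs) ≤ m
      rest≤m = ≤-trans (m≤n+m _ (1 + length H))
                 (s≤s⁻¹ (subst (_≤ suc m) length-cut xs≤m))
      module K = Kept (keep m (ps ++ qs) rest≤m rest-sorted)

    keep m       []       _    _ = record
      { L      = []
      ; unique = []
      ; L⊆xs   = id
      ; layout = record
        { bags = [] ; small = [] ; within = λ () ; linked = λ () ; convex = tt }
      ; many   = z≤n
      }
    keep (suc m) (x ∷ xs) xs≤m s with length xs ≤? 4
    keep (suc m) (x ∷ xs) xs≤m s | yes xs≤4 = record
      { L      = x ∷ xs
      ; unique = Sorted⇒Unique s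
      ; L⊆xs   = id
      ; layout = pentagon-layout s xs≤4
      ; many   = *-monoˡ-≤ (suc (length xs)) {5} {7} (m≤m+n 5 2)
      }
    keep (suc m) (x ∷ [])     xs≤m s | no xs≰4 = contradiction z≤n xs≰4
    keep (suc m) (x ∷ y ∷ ys) xs≤m s | no xs≰4 with length ys ≤? 4
    -- There are exactly six vertices, one too few for `wholeCut`; dropping the first leaves a
    -- pentagon, and five of six exceeds five sevenths.
    ... | yes ys≤4 = record
      { L      = y ∷ ys
      ; unique = Sorted⇒Unique (AllPairs.tail s)
      ; L⊆xs   = there
      ; layout = pentagon-layout (AllPairs.tail s) ys≤4
      ; many   = drop-count (≰⇒> xs≰4)
      }
    ... | no ys≰4 =
      let c , layoutH = minimalCut _ s (wholeCut x (y ∷ ys) (s≤s (≰⇒> ys≰4))) ≤-refl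
      in keep-cut m xs≤m s c layoutH

    5n≤7I₂ : 5 * n ≤ 7 * I₂ G
    5n≤7I₂ = begin
      5 * n            ≡⟨ cong (5 *_) (length-tabulate (placement ⟨$⟩ˡ_)) ⟨
      5 * length xs    ≤⟨ K.many ⟩
      7 * length K.L   ≤⟨ *-monoʳ-≤ 7 (length≤I₂ K.unique K.layout) ⟩
      7 * I₂ G         ∎
      where
      open ≤-Reasoning
      -- The inverse of `placement` lists the vertices in their order around the circle.
      xs = tabulate (placement ⟨$⟩ˡ_)
      xs-sorted : Sorted xs
      xs-sorted = AllPairs.tabulate⁺-< λ {i} {j} i<j →
        subst₂ Fin._<_ (sym (inverseʳ placement)) (sym (inverseʳ placement)) i<j
      module K = Kept (keep (length xs) xs ≤-refl xs-sorted)

theorem5 : (n : ℕ) (G : Graph n) → Outerplanar G → 7 * I₂ G ≥ 5 * n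
theorem5 n G drawing = 5n≤7I₂ G drawing
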